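{- (i) For each $n$, $\mathcal{T}_n$ is a transparent spread, and if $n>0$ then $\mathcal{I}(\mathcal{T}_n)=\{\alpha\in\mathcal{T}_n\mid\exists p[\alpha(p)+1=n]\}$ and $\mathcal{L}(\mathcal{T}_n)=\mathcal{T}_{n-1}$. (ii) For all $n$ and all $m>0$, $\mathcal{T}_n=\{\alpha\in\mathcal{T}_{n+m}\mid(\mathcal{T}_{n+m},=)\models\bigwedge_{i<m}\neg D_i[\alpha]\}$. (iii) For all $m$, $\{\underline{0}\}=\mathcal{T}_1=\{\alpha\in\mathcal{T}_{m+1}\mid(\mathcal{T}_{m+1},=)\models\bigwedge_{i<m}\neg D_i[\alpha]\}$. (iv) For all $n>0$ and $m>0$, $(\mathcal{T}_n,=)\models\psi_m$ if and only if $m+1\le n$. (v) For all $n>0$ and $m>0$, $(\mathcal{T}_n,=)\models\rho_m$ if and only if $m+1=n$.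
   Context: Intuitionistic mathematics (constructive reading of logical constants; Markov's Principle not assumed), with Brouwer's Continuity Principle as an axiom (for every $R\subseteq\mathcal{N}\times\omega$, if $\forall\alpha\exists n[\alpha Rn]$ then $\forall\alpha\exists m\exists n\forall\beta[\overline{\alpha}m\sqsubset\beta\rightarrow\beta Rn]$). $\mathcal{N}=\omega^\omega$; $\overline{\alpha}n=\langle\alpha(0),\dots,\alpha(n-1)\rangle$; $s\sqsubset\alpha$: $s$ is an initial segment of $\alpha$; $\alpha\perp\delta$ iff $\exists n[\alpha(n)\neq\delta(n)]$. $\mathcal{F}_\beta:=\{\alpha\mid\forall n[\beta(\overline{\alpha}n)=0]\}$; $Spr(\beta)$ iff $\forall s[\beta(s)=0\leftrightarrow\exists n[\beta(s\ast\langle n\rangle)=0]]$. $\mathcal{T}_n:=\{\alpha\mid\forall i[\alpha(i)\le\alpha(i+1)<n]\}$ (a spread; $\mathcal{T}_0=\emptyset$, $\mathcal{T}_1=\{\underline{0}\}$). For a spread $\mathcal{F}$: $\alpha\in\mathcal{F}$ is isolated iff $\exists n\forall\gamma\in\mathcal{F}[\overline{\alpha}n\sqsubset\gamma\rightarrow\alpha=\gamma]$, $\mathcal{I}(\mathcal{F})$ is the set of isolated points; $\alpha\in\mathcal{F}$ is a limit point iff $\forall n\exists\delta\in\mathcal{F}[\overline{\alpha}n\sqsubset\delta\wedge\alpha\perp\delta]$, $\mathcal{L}(\mathcal{F})$ is the set of limit points. For $Spr(\beta)$, $\mathcal{F}_\beta$ is transparent iff there is $\gamma$ with $Spr(\gamma)$,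 $\mathcal{F}_\gamma=\mathcal{L}(\mathcal{F}_\beta)$ and $\forall\alpha\in\mathcal{F}_\beta[\exists n[\gamma(\overline{\alpha}n)\neq0]\rightarrow\alpha\in\mathcal{I}(\mathcal{F}_\beta)]$. Formulas (language with only $=$): $D_0(\mathsf{x}):=\forall\mathsf{y}[\mathsf{x}=\mathsf{y}\vee\neg(\mathsf{x}=\mathsf{y})]$ and, for $m>0$, $D_m(\mathsf{x}):=\bigwedge_{i<m}\neg D_i(\mathsf{x})\wedge\forall\mathsf{y}[\bigwedge_{i<m}\neg D_i(\mathsf{y})\rightarrow(\mathsf{x}=\mathsf{y}\vee\neg(\mathsf{x}=\mathsf{y}))]$; for $m>0$, $\psi_m:=\exists\mathsf{x}[D_m(\mathsf{x})]$ and $\rho_m:=\exists\mathsf{x}[D_m(\mathsf{x})\wedge\forall\mathsf{y}[D_m(\mathsf{y})\rightarrow\mathsf{y}=\mathsf{x}]]$. An empty conjunction is true. Satisfaction is read intuitionistically, $=$ interpreted as equality of sequences. -}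

module Defs where

open import Level using (Level; Lift; 0ℓ; _⊔_) renaming (suc to lsuc)
open import Data.Nat.Base using (ℕ; zero; suc; _≤_; _<_)
open import Data.Fin.Base using (Fin; zero; suc)
open import Data.List.Base using (List; length; applyUpTo; _∷ʳ_)
open import Data.Vec.Base using (Vec; _∷_; lookup)
open import Data.Product.Base using (Σ; _×_)
open import Data.Sum.Base using (_⊎_)
open import Data.Unit.Polymorphic.Base using (⊤)
open import Function.Bundles using (_⇔_)
open import Relation.Binary.PropositionalEquality using (_≡_; _≢_; _≗_)
open import Relation.Nullary using (¬_; Irrelevant)
open import Relation.Unary using (Pred; _∈_; _≐_)

1ℓ : Level
1ℓ = lsuc 0ℓ

private
  variable
    a p : Level
    k : ℕ

-- Intuitionistic ∃ and ∨ carry no choice of witness that other data may depend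
-- on.  They are therefore rendered by propositionally truncated Σ and ⊎: with a
-- bare Σ the Continuity Principle below would be refutable (Escardó and Xu),
-- and anything assuming it would hold vacuously.  Since `Irrelevant P` says
-- that P has at most one element, this is the usual encoding of the truncation
-- by its elimination into propositions.
∥_∥ : Set a → Set (1ℓ ⊔ a)
∥ A ∥ = (P : Set) → Irrelevant P → (A → P) → P

infixr 1 _∨_
_∨_ : Set a → Set p → Set (1ℓ ⊔ a ⊔ p)
A ∨ B = ∥ A ⊎ B ∥

∃ : {A : Set a} → (A → Set p) → Set (1ℓ ⊔ a ⊔ p)
∃ {A = A} P = ∥ Σ A P ∥

infix 2 ∃-syntax
∃-syntax : (A : Set a) → (A → Set p) → Set (1ℓ ⊔ a ⊔ p)
∃-syntax A P = ∃ {A = A} P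

syntax ∃-syntax A (λ x → P) = ∃[ x ∶ A ] P

-- Equality of sequences is pointwise equality _≗_.
𝒩 : Set
𝒩 = ℕ → ℕ

-- Finite sequences of natural numbers are lists rather than numerical codes;
-- the initial segment ⟨α(0),…,α(n-1)⟩ is applyUpTo α n.
_⊏_ : List ℕ → 𝒩 → Set
s ⊏ α = applyUpTo α (length s) ≡ s

_⊥_ : 𝒩 → 𝒩 → Set₁
α ⊥ δ = ∃[ n ∶ ℕ ] α n ≢ δ n

-- A subset of 𝒩 × ω respects equality of sequences.  Truncating R in the
-- conclusion makes it a statement about R as a mere relation.
ContinuityPrinciple : Set₂
ContinuityPrinciple =
  (R : 𝒩 → ℕ → Set₁) →
  (∀ {α β n} → α ≗ β → R α n → R β n) →
  (∀ α → ∃[ n ∶ ℕ ] R α n) →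
  ∀ α → ∃[ m ∶ ℕ ] ∃[ n ∶ ℕ ] (∀ β → applyUpTo α m ⊏ β → ∥ R β n ∥)

ℱ : (List ℕ → ℕ) → Pred 𝒩 0ℓ
ℱ β α = ∀ n → β (applyUpTo α n) ≡ 0

Spr : (List ℕ → ℕ) → Set₁
Spr β = ∀ s → β s ≡ 0 ⇔ (∃[ n ∶ ℕ ] β (s ∷ʳ n) ≡ 0)

ℐ : Pred 𝒩 0ℓ → Pred 𝒩 1ℓ
ℐ F α = α ∈ F × (∃[ n ∶ ℕ ] (∀ γ → γ ∈ F → applyUpTo α n ⊏ γ → α ≗ γ))

ℒ : Pred 𝒩 0ℓ → Pred 𝒩 1ℓ
ℒ F α = α ∈ F × (∀ n → ∃[ δ ∶ 𝒩 ] (δ ∈ F × applyUpTo α n ⊏ δ × α ⊥ δ))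

Transparent : (List ℕ → ℕ) → Set₁
Transparent β =
  ∃[ γ ∶ (List ℕ → ℕ) ]
    (Spr γ × ℱ γ ≐ ℒ (ℱ β) ×
     (∀ α → α ∈ ℱ β → (∃[ n ∶ ℕ ] γ (applyUpTo α n) ≢ 0) → α ∈ ℐ (ℱ β)))

IsTransparentSpread : Pred 𝒩 0ℓ → Set₁
IsTransparentSpread F =
  ∃[ β ∶ (List ℕ → ℕ) ] (Spr β × ℱ β ≐ F × Transparent β)

𝒯 : ℕ → Pred 𝒩 0ℓ
𝒯 n α = ∀ i → α i ≤ α (suc i) × α (suc i) < n

-- First-order formulas over equality, with free variables in Fin k (de Bruijn
-- indices: ∀̇ and ∃̇ bind zero).
infix  8 _≡̇_
infix  7 ¬̇_
infixr 6 _∧̇_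
infixr 5 _∨̇_
infixr 4 _⇒̇_
infix  3 ∀̇_ ∃̇_

data Formula (k : ℕ) : Set where
  _≡̇_           : Fin k → Fin k → Formula k
  ⊤̇             : Formula k
  _∧̇_ _∨̇_ _⇒̇_ : Formula k → Formula k → Formula k
  ¬̇_            : Formula k → Formula k
  ∀̇_ ∃̇_        : Formula (suc k) → Formula k

-- X ⊨ φ [ ρ ]: satisfaction in the structure (X, =) under the assignment ρ.
infix 3 _⊨_[_]
_⊨_[_] : Pred 𝒩 0ℓ → Formula k → Vec 𝒩 k → Set₁
X ⊨ x ≡̇ y [ ρ ]  = Lift 1ℓ (lookup ρ x ≗ lookup ρ y)
X ⊨ ⊤̇ [ ρ ]      = ⊤
X ⊨ φ ∧̇ χ [ ρ ]  = (X ⊨ φ [ ρ ]) × (X ⊨ χ [ ρ ])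
X ⊨ φ ∨̇ χ [ ρ ]  = (X ⊨ φ [ ρ ]) ∨ (X ⊨ χ [ ρ ])
X ⊨ φ ⇒̇ χ [ ρ ]  = X ⊨ φ [ ρ ] → X ⊨ χ [ ρ ]
X ⊨ ¬̇ φ [ ρ ]    = ¬ (X ⊨ φ [ ρ ])
X ⊨ ∀̇ φ [ ρ ]    = ∀ α → α ∈ X → X ⊨ φ [ α ∷ ρ ]
X ⊨ ∃̇ φ [ ρ ]    = ∃[ α ∶ 𝒩 ] (α ∈ X × (X ⊨ φ [ α ∷ ρ ]))

-- D m x is D_m(x), and ⋀¬D m x is ⋀_{i<m} ¬ D_i(x).
mutual
  D : ℕ → Fin k → Formula k
  D zero x = ∀̇ (suc x ≡̇ zero ∨̇ ¬̇ (suc x ≡̇ zero))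
  D (suc m) x =
    ⋀¬D (suc m) x ∧̇
    (∀̇ (⋀¬D (suc m) zero ⇒̇ (suc x ≡̇ zero ∨̇ ¬̇ (suc x ≡̇ zero))))

  ⋀¬D : ℕ → Fin k → Formula k
  ⋀¬D zero    x = ⊤̇
  ⋀¬D (suc m) x = ⋀¬D m x ∧̇ ¬̇ D m x

ψ : ℕ → Formula 0
ψ m = ∃̇ D m zero

ρ : ℕ → Formula 0
ρ m = ∃̇ (D m zero ∧̇ (∀̇ (D m zero ⇒̇ zero ≡̇ suc zero)))

{-# OPTIONS --safe #-}

-- A point of 𝒯 (n+1) that takes the value n is determined by a finite initial
-- segment, so equality with it is decidable.  At a point α of 𝒯 n it is not:
-- composing with a retraction of 𝒩 onto 𝒯 (n+1), the Continuity Principle would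
-- yield an N such that every point agreeing with α below N equals α, but α can
-- be made to jump to n at N.  Hence, within 𝒯 (n+1), ¬ D₀ defines 𝒯 n, and
-- relativising to 𝒯 n and iterating, ⋀_{i<m} ¬ D_i defines 𝒯 n within 𝒯 (n+m).
module Submission where

open import Defs hiding (_⊥_)
open import Level using (Level; Lift; lift; lower)
open import Data.Nat.Base using (ℕ; zero; suc; _+_; _∸_; _≤_; _<_; _>_; z≤n; s≤s; _⊔_; _⊓_)
open import Data.Nat.Properties
open import Data.Fin.Base using (Fin; zero; suc)
open import Data.List.Base using (List; []; _∷_; applyUpTo; _∷ʳ_)
open import Data.List.Properties using (length-applyUpTo; ∷-injective)
open import Data.Product.Base using (Σ; _×_; _,_; proj₁; proj₂)
open import Data.Sum.Base using (_⊎_; inj₁; inj₂)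
open import Data.Vec.Base using (Vec; []; _∷_; lookup)
open import Data.Empty using (⊥; ⊥-elim)
open import Data.Unit.Polymorphic.Base using (tt)
open import Function.Base using (_∘_; id)
open import Function.Bundles using (_⇔_; mk⇔; module Equivalence)
open import Relation.Binary.PropositionalEquality using (_≡_; _≢_; _≗_; refl; sym; trans; cong; cong₂; subst)
open import Relation.Nullary using (¬_; Dec; yes; no)
open import Relation.Nullary.Decidable using (_×-dec_; map′)
open import Relation.Unary using (_∈_; _≐_)

open Equivalence using (to; from)

private
  variable
    a b : Level
    A : Set a
    B : Set b
    k m n N : ℕ
    α γ : 𝒩

-- Propositional truncation

∣_∣ : A → ∥ A ∥
∣ x ∣ _ _ f = f x

∥∥-map : (A → B) → ∥ A ∥ → ∥ B ∥
∥∥-map g t P irr f = t P irr (f ∘ g)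

-- `⊥` lies in `Set` and has at most one element, so truncated witnesses may be opened whenever the
-- goal is a contradiction.
∥∥-absurd : ∥ A ∥ → ¬ ¬ A
∥∥-absurd t = t ⊥ (λ ())

-- Initial segments

applyUpTo-cong : ∀ N → (∀ i → i < N → γ i ≡ α i) → applyUpTo γ N ≡ applyUpTo α N
applyUpTo-cong zero    h = refl
applyUpTo-cong (suc N) h =
  cong₂ _∷_ (h 0 (s≤s z≤n)) (applyUpTo-cong N (λ i i<N → h (suc i) (s≤s i<N)))

applyUpTo-injective : ∀ N → applyUpTo γ N ≡ applyUpTo α N → ∀ i → i < N → γ i ≡ α i
applyUpTo-injective (suc N) eq zero    _         = proj₁ (∷-injective eq)
applyUpTo-injective (suc N) eq (suc i) (s≤s i<N) =
  applyUpTo-injective N (proj₂ (∷-injective eq)) i i<N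

agree⇒⊏ : ∀ N → (∀ i → i < N → γ i ≡ α i) → applyUpTo α N ⊏ γ
agree⇒⊏ {α = α} N h rewrite length-applyUpTo α N = applyUpTo-cong N h

⊏⇒agree : ∀ N → applyUpTo α N ⊏ γ → ∀ i → i < N → γ i ≡ α i
⊏⇒agree {α = α} N p rewrite length-applyUpTo α N = applyUpTo-injective N p

-- Elements of 𝒯

𝒯-bound : α ∈ 𝒯 n → ∀ i → α i < n
𝒯-bound α∈ i = ≤-<-trans (proj₁ (α∈ i)) (proj₂ (α∈ i))

𝒯-weaken : m ≤ n → α ∈ 𝒯 m → α ∈ 𝒯 n
𝒯-weaken m≤n α∈ i = proj₁ (α∈ i) , <-≤-trans (proj₂ (α∈ i)) m≤n

𝒯-strengthen : α ∈ 𝒯 (suc n) → (∀ p → α p ≢ n) → α ∈ 𝒯 n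
𝒯-strengthen α∈ ≢n i =
  proj₁ (α∈ i) , ≤∧≢⇒< (≤-pred (proj₂ (α∈ i))) (≢n (suc i))

𝒯-respects-≗ : α ≗ γ → α ∈ 𝒯 n → γ ∈ 𝒯 n
𝒯-respects-≗ α≗γ α∈ i
  rewrite sym (α≗γ i) | sym (α≗γ (suc i)) = α∈ i

¬𝒯0 : ¬ (α ∈ 𝒯 0)
¬𝒯0 α∈ with proj₂ (α∈ 0)
... | ()

𝒯1-zero : α ∈ 𝒯 1 → ∀ i → α i ≡ 0
𝒯1-zero α∈ i = n<1⇒n≡0 (𝒯-bound α∈ i)

𝒯-mono : α ∈ 𝒯 n → ∀ {i j} → i ≤ j → α i ≤ α j
𝒯-mono         α∈ {_} {zero}  z≤n       = ≤-refl
𝒯-mono         α∈ {_} {suc j} z≤n       = ≤-trans (𝒯-mono α∈ {0} {j} z≤n) (proj₁ (α∈ j))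
𝒯-mono {α = α} α∈             (s≤s i≤j) = 𝒯-mono {α = α ∘ suc} (α∈ ∘ suc) i≤j

𝒯-top : α ∈ 𝒯 (suc k) → ∀ {p i} → α p ≡ k → p ≤ i → α i ≡ k
𝒯-top α∈ {i = i} refl p≤i = ≤-antisym (≤-pred (𝒯-bound α∈ i)) (𝒯-mono α∈ p≤i)

-- From `p` on, both sequences are stuck at the maximal value `k`; before `p` they agree by
-- hypothesis.
𝒯-determined : α ∈ 𝒯 (suc k) → γ ∈ 𝒯 (suc k) → ∀ p → α p ≡ k →
               (∀ i → i < suc p → γ i ≡ α i) → α ≗ γ
𝒯-determined α∈ γ∈ p αp≡k h i with <-≤-connex i p
... | inj₁ i<p = sym (h i (m≤n⇒m≤1+n i<p))
... | inj₂ p≤i =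
  trans (𝒯-top α∈ αp≡k p≤i) (sym (𝒯-top γ∈ (trans (h p (n<1+n p)) αp≡k) p≤i))

const∈𝒯 : ∀ k → (λ _ → k) ∈ 𝒯 (suc k)
const∈𝒯 k _ = ≤-refl , n<1+n k

-- Shifting `α` while counting `N` down avoids a test `i < N`, so concrete jumps compute.
jump : 𝒩 → ℕ → ℕ → 𝒩
jump α zero    k _       = k
jump α (suc N) k zero    = α 0
jump α (suc N) k (suc i) = jump (α ∘ suc) N k i

jump-agrees : ∀ α N i → i < N → jump α N k i ≡ α i
jump-agrees α (suc N) zero    _         = refl
jump-agrees α (suc N) (suc i) (s≤s i<N) = jump-agrees (α ∘ suc) N i i<N

jump-at : ∀ α N → jump α N k N ≡ k
jump-at α zero    = refl
jump-at α (suc N) = jump-at (α ∘ suc) N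

jump∈𝒯 : ∀ N → α ∈ 𝒯 (suc k) → jump α N k ∈ 𝒯 (suc k)
jump∈𝒯 {k = k} zero          α∈ i       = const∈𝒯 k i
jump∈𝒯 {k = k} (suc zero)    α∈ zero    = ≤-pred (𝒯-bound α∈ 0) , n<1+n k
jump∈𝒯         (suc (suc N)) α∈ zero    = α∈ 0
jump∈𝒯 {α}     (suc N)       α∈ (suc i) = jump∈𝒯 {α ∘ suc} N (α∈ ∘ suc) i

jump-⊏ : ∀ α N → applyUpTo α N ⊏ jump α N k
jump-⊏ α N = agree⇒⊏ N (jump-agrees α N)

𝒯-jump-≢ : α ∈ 𝒯 k → ∀ N → α N ≢ jump α N k N
𝒯-jump-≢ {α} α∈ N eq = <⇒≢ (𝒯-bound α∈ N) (trans eq (jump-at α N))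

-- Isolated points and limit points

-- A neighbourhood of `α` fixed by its first `N` values contains the jump to `k` at `N`. If `α` is
-- alone there, it equals that jump and so takes the value `k` at `N`.
ℐ𝒯-to : α ∈ ℐ (𝒯 (suc k)) → ∃[ p ∶ ℕ ] α p ≡ k
ℐ𝒯-to {α} (α∈ , iso) = ∥∥-map
  (λ (N , h) → N , trans (h _ (jump∈𝒯 N α∈) (jump-⊏ α N) N) (jump-at α N)) iso

ℐ𝒯-from : α ∈ 𝒯 (suc k) → ∃[ p ∶ ℕ ] α p ≡ k → α ∈ ℐ (𝒯 (suc k))
ℐ𝒯-from α∈ t = α∈ , ∥∥-map
  (λ (p , αp≡k) → suc p , λ γ γ∈ α⊏γ → 𝒯-determined α∈ γ∈ p αp≡k (⊏⇒agree (suc p) α⊏γ)) t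

-- A value `k` at `p` would leave no room for an element apart from `α` that shares its first
-- `suc p` values.
ℒ𝒯-to : α ∈ ℒ (𝒯 (suc k)) → α ∈ 𝒯 k
ℒ𝒯-to {k = k} (α∈ , lim) = 𝒯-strengthen α∈ λ p αp≡k →
  ∥∥-absurd (lim (suc p)) λ (δ , δ∈ , α⊏δ , α⊥δ) →
  ∥∥-absurd α⊥δ λ (i , αi≢δi) →
  αi≢δi (𝒯-determined α∈ δ∈ p αp≡k (⊏⇒agree (suc p) α⊏δ) i)

ℒ𝒯-from : α ∈ 𝒯 k → α ∈ ℒ (𝒯 (suc k))
ℒ𝒯-from {α} {k} α∈ = α∈′ , λ N →
  ∣ jump α N k , jump∈𝒯 N α∈′ , jump-⊏ α N , ∣ N , 𝒯-jump-≢ α∈ N ∣ ∣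
  where α∈′ = 𝒯-weaken (n≤1+n k) α∈

ℐ-resp-≐ : ∀ {F G} → F ≐ G → α ∈ ℐ F → α ∈ ℐ G
ℐ-resp-≐ (F⊆G , G⊆F) (α∈ , iso) =
  F⊆G α∈ , ∥∥-map (λ (N , h) → N , λ γ γ∈ → h γ (G⊆F γ∈)) iso

ℒ-resp-≐ : ∀ {F G} → F ≐ G → α ∈ ℒ F → α ∈ ℒ G
ℒ-resp-≐ (F⊆G , G⊆F) (α∈ , lim) =
  F⊆G α∈ , λ N → ∥∥-map (λ (δ , δ∈ , r) → δ , F⊆G δ∈ , r) (lim N)

-- The spread law of 𝒯

-- l ∷ s is non-decreasing with all entries below n.
Adm : ℕ → ℕ → List ℕ → Set
Adm n l []      = l < n
Adm n l (x ∷ s) = l ≤ x × Adm n x s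

adm? : ∀ n l s → Dec (Adm n l s)
adm? n l []      = l <? n
adm? n l (x ∷ s) = (l ≤? x) ×-dec adm? n x s

adm-extend : ∀ l s → Adm n l s → Σ ℕ λ x → Adm n l (s ∷ʳ x)
adm-extend l []      l<n       = l , ≤-refl , l<n
adm-extend l (x ∷ s) (l≤x , p) = let y , q = adm-extend x s p in y , l≤x , q

adm-restrict : ∀ l s {x} → Adm n l (s ∷ʳ x) → Adm n l s
adm-restrict l []      (l≤x , x<n) = ≤-<-trans l≤x x<n
adm-restrict l (y ∷ s) (l≤y , p)   = l≤y , adm-restrict y s p

𝒯⇒adm : ∀ {l} → l ≤ α 0 → α ∈ 𝒯 n → ∀ N → Adm n l (applyUpTo α N)
𝒯⇒adm     l≤α0 α∈ zero    = ≤-<-trans l≤α0 (𝒯-bound α∈ 0)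
𝒯⇒adm {α} l≤α0 α∈ (suc N) = l≤α0 , 𝒯⇒adm {α ∘ suc} (proj₁ (α∈ 0)) (α∈ ∘ suc) N

adm⇒𝒯 : ∀ {l} → (∀ N → Adm n l (applyUpTo α N)) → α ∈ 𝒯 n
adm⇒𝒯     h zero    = proj₂ (h 2)
adm⇒𝒯 {α = α} h (suc i) = adm⇒𝒯 {α = α ∘ suc} (λ N → proj₂ (h (suc N))) i

-- Monotonicity of the segment cannot fail, so the bound does: its last entry (or `l`, if it is
-- empty) is at least `k`, and the next value of `α` must be `k`. The position `p` found is `N`
-- itself.
¬adm⇒top : ∀ {l} → l ≤ α 0 → α ∈ 𝒯 (suc k) → ∀ N → ¬ Adm k l (applyUpTo α N) →
           Σ ℕ λ p → α p ≡ k
¬adm⇒top l≤α0 α∈ zero ¬l<k =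
  0 , ≤-antisym (≤-pred (𝒯-bound α∈ 0)) (≤-trans (≮⇒≥ ¬l<k) l≤α0)
¬adm⇒top {α} l≤α0 α∈ (suc N) ¬p =
  let p , eq = ¬adm⇒top {α ∘ suc} (proj₁ (α∈ 0)) (α∈ ∘ suc) N (λ q → ¬p (l≤α0 , q))
  in suc p , eq

lawOf : {A : Set} → Dec A → ℕ
lawOf (yes _) = 0
lawOf (no _)  = 1

lawOf-to : {A : Set} (A? : Dec A) → lawOf A? ≡ 0 → A
lawOf-to (yes x) _ = x

lawOf-from : {A : Set} (A? : Dec A) → A → lawOf A? ≡ 0
lawOf-from (yes _) _ = refl
lawOf-from (no ¬x) x = ⊥-elim (¬x x)

-- The lower bound `0` does not constrain the first entry. For `n` equal to `0` even the empty list
-- is rejected, which gives the empty spread.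
τ : ℕ → List ℕ → ℕ
τ n s = lawOf (adm? n 0 s)

τ-spread : ∀ n → Spr (τ n)
τ-spread n s = mk⇔
  (λ eq → let x , q = adm-extend 0 s (lawOf-to (adm? n 0 s) eq)
          in ∣ x , lawOf-from (adm? n 0 (s ∷ʳ x)) q ∣)
  -- The goal is an equation between numbers, which has at most one proof, so the truncated witness
  -- may be used.
  (λ t → t _ ≡-irrelevant λ (x , eq) →
     lawOf-from (adm? n 0 s) (adm-restrict 0 s (lawOf-to (adm? n 0 (s ∷ʳ x)) eq)))

ℱτ≐𝒯 : ∀ n → ℱ (τ n) ≐ 𝒯 n
ℱτ≐𝒯 n =
  (λ {α} h → adm⇒𝒯 (λ N → lawOf-to (adm? n 0 (applyUpTo α N)) (h N))) ,
  (λ {α} α∈ N → lawOf-from (adm? n 0 (applyUpTo α N)) (𝒯⇒adm z≤n α∈ N))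

≐-sym : ∀ {p q} {P : 𝒩 → Set p} {Q : 𝒩 → Set q} → P ≐ Q → Q ≐ P
≐-sym (f , g) = g , f

ℱτ≐ℒ : ∀ n → ℱ (τ (n ∸ 1)) ≐ ℒ (ℱ (τ n))
ℱτ≐ℒ zero = (λ h → ⊥-elim (¬𝒯0 (proj₁ (ℱτ≐𝒯 0) h))) , proj₁
ℱτ≐ℒ (suc k) =
  (λ h → ℒ-resp-≐ (≐-sym (ℱτ≐𝒯 (suc k))) (ℒ𝒯-from (proj₁ (ℱτ≐𝒯 k) h))) ,
  (λ h → proj₂ (ℱτ≐𝒯 k) (ℒ𝒯-to (ℒ-resp-≐ (ℱτ≐𝒯 (suc k)) h)))

τ-leave⇒ℐ : ∀ n α → α ∈ ℱ (τ n) → ∃[ N ∶ ℕ ] τ (n ∸ 1) (applyUpTo α N) ≢ 0 → α ∈ ℐ (ℱ (τ n))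
τ-leave⇒ℐ zero    α α∈ _ = ⊥-elim (¬𝒯0 (proj₁ (ℱτ≐𝒯 0) α∈))
τ-leave⇒ℐ (suc k) α α∈ t = ℐ-resp-≐ (≐-sym (ℱτ≐𝒯 (suc k))) (ℐ𝒯-from α∈𝒯
  (∥∥-map (λ (N , ≢0) → ¬adm⇒top z≤n α∈𝒯 N (≢0 ∘ lawOf-from (adm? k 0 (applyUpTo α N)))) t))
  where α∈𝒯 = proj₁ (ℱτ≐𝒯 (suc k)) α∈

τ-transparent : ∀ n → Transparent (τ n)
τ-transparent n = ∣ τ (n ∸ 1) , τ-spread (n ∸ 1) , ℱτ≐ℒ n , τ-leave⇒ℐ n ∣

-- Points at which equality is decidable

-- This is what satisfaction of `D 0` in `X` unfolds to, which is why `Lift` appears.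
Discrete : (𝒩 → Set) → 𝒩 → Set₁
Discrete X α = ∀ γ → γ ∈ X → Lift 1ℓ (α ≗ γ) ∨ ¬ Lift 1ℓ (α ≗ γ)

≗-dec : α ∈ 𝒯 (suc k) → γ ∈ 𝒯 (suc k) → ∀ p → α p ≡ k → Dec (α ≗ γ)
≗-dec {α} {γ = γ} α∈ γ∈ p αp≡k = map′
  (λ h → 𝒯-determined α∈ γ∈ p αp≡k (λ i i<1+p → h {i} i<1+p))
  (λ α≗γ {i} _ → sym (α≗γ i))
  (allUpTo? (λ i → γ i ≟ α i) (suc p))

top⇒Discrete : α ∈ 𝒯 (suc k) → ∀ p → α p ≡ k → Discrete (𝒯 (suc k)) α
top⇒Discrete α∈ p αp≡k γ γ∈ with ≗-dec α∈ γ∈ p αp≡k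
... | yes α≗γ = ∣ inj₁ (lift α≗γ) ∣
... | no  α≇γ = ∣ inj₂ (α≇γ ∘ lower) ∣

-- The running maximum of `α` cut off at `k`. It carries the Continuity Principle, which speaks of
-- all of `𝒩`, over to `𝒯 (suc k)`.
retract : ℕ → 𝒩 → 𝒩
retract k α zero    = α 0 ⊓ k
retract k α (suc i) = retract k α i ⊔ (α (suc i) ⊓ k)

retract-≤ : ∀ k α i → retract k α i ≤ k
retract-≤ k α zero    = m⊓n≤n (α 0) k
retract-≤ k α (suc i) = ⊔-lub (retract-≤ k α i) (m⊓n≤n (α (suc i)) k)

retract∈𝒯 : ∀ k α → retract k α ∈ 𝒯 (suc k)
retract∈𝒯 k α i = m≤m⊔n _ _ , s≤s (retract-≤ k α (suc i))

retract-cong : ∀ k → α ≗ γ → retract k α ≗ retract k γ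
retract-cong k α≗γ zero    = cong (_⊓ k) (α≗γ 0)
retract-cong k α≗γ (suc i) =
  cong₂ _⊔_ (retract-cong k α≗γ i) (cong (_⊓ k) (α≗γ (suc i)))

retract-fixes : α ∈ 𝒯 (suc k) → retract k α ≗ α
retract-fixes α∈ zero    = m≤n⇒m⊓n≡m (≤-pred (𝒯-bound α∈ 0))
retract-fixes α∈ (suc i) = trans
  (cong₂ _⊔_ (retract-fixes α∈ i) (m≤n⇒m⊓n≡m (≤-pred (𝒯-bound α∈ (suc i)))))
  (m≤n⇒m⊔n≡n (proj₁ (α∈ i)))

𝒯⇒¬Discrete : ContinuityPrinciple → α ∈ 𝒯 k → ¬ Discrete (𝒯 (suc k)) α
𝒯⇒¬Discrete {α} {k} cp α∈ disc =
  ∥∥-absurd (cp R R-resp R-total α) λ (N , t) → ∥∥-absurd t λ (c , h) →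
  ∥∥-absurd (h α (agree⇒⊏ N (λ _ _ → refl))) λ Rα →
  ∥∥-absurd (h (jump α N k) (jump-⊏ α N)) λ Rδ →
  clash N Rα Rδ
  where
  α∈′ : α ∈ 𝒯 (suc k)
  α∈′ = 𝒯-weaken (n≤1+n k) α∈

  -- The number `c` encodes which disjunct holds when `α` is compared with the retraction of `γ`.
  R : 𝒩 → ℕ → Set₁
  R γ c = Lift 1ℓ ((c ≡ 0 × α ≗ retract k γ) ⊎ (c ≡ 1 × ¬ (α ≗ retract k γ)))

  R-resp : ∀ {γ δ c} → γ ≗ δ → R γ c → R δ c
  R-resp γ≗δ (lift (inj₁ (c≡0 , eq))) =
    lift (inj₁ (c≡0 , λ i → trans (eq i) (retract-cong k γ≗δ i)))
  R-resp γ≗δ (lift (inj₂ (c≡1 , ¬eq))) =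
    lift (inj₂ (c≡1 , λ eq → ¬eq (λ i → trans (eq i) (sym (retract-cong k γ≗δ i)))))

  R-total : ∀ γ → ∃[ c ∶ ℕ ] R γ c
  R-total γ = ∥∥-map
    (λ { (inj₁ (lift eq)) → 0 , lift (inj₁ (refl , eq))
       ; (inj₂ ¬eq)       → 1 , lift (inj₂ (refl , ¬eq ∘ lift)) })
    (disc (retract k γ) (retract∈𝒯 k γ))

  -- Since the retraction fixes `α`, the code `c` must be `0`. The jump lies in the same
  -- neighbourhood and shares this code, so `α` would equal it, although they differ at `N`.
  clash : ∀ N {c} → R α c → R (jump α N k) c → ⊥
  clash N (lift (inj₂ (_ , ¬eq))) _ = ¬eq (λ i → sym (retract-fixes α∈′ i))
  clash N (lift (inj₁ (refl , _))) (lift (inj₁ (_ , eq))) =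
    𝒯-jump-≢ α∈ N (trans (eq N) (retract-fixes (jump∈𝒯 N α∈′) N))

¬Discrete⇒𝒯 : α ∈ 𝒯 (suc k) → ¬ Discrete (𝒯 (suc k)) α → α ∈ 𝒯 k
¬Discrete⇒𝒯 α∈ ¬disc = 𝒯-strengthen α∈ λ p αp≡k → ¬disc (top⇒Discrete α∈ p αp≡k)

-- The formulas D

-- The guard `⋀¬D 0` is trivially true, so `D 0` fits the pattern of the other `D m` and later
-- arguments need no case split.
D-⇔ : ∀ {X j} m (x : Fin j) (e : Vec 𝒩 j) →
      (X ⊨ D m x [ e ]) ⇔
      ((X ⊨ ⋀¬D m x [ e ]) ×
       (∀ γ → γ ∈ X → X ⊨ ⋀¬D m zero [ γ ∷ e ] →
        Lift 1ℓ (lookup e x ≗ γ) ∨ ¬ Lift 1ℓ (lookup e x ≗ γ)))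
D-⇔ zero    x e = mk⇔ (λ h → tt , λ γ γ∈ _ → h γ γ∈) (λ (_ , h) γ γ∈ → h γ γ∈ tt)
D-⇔ (suc m) x e = mk⇔ id id

⋀¬D-weaken : ∀ {X j} {x : Fin j} {e} → m ≤ n → X ⊨ ⋀¬D n x [ e ] → X ⊨ ⋀¬D m x [ e ]
⋀¬D-weaken {m} {n} m≤n h with m≤n⇒m<n∨m≡n m≤n
⋀¬D-weaken         _ h       | inj₂ refl      = h
⋀¬D-weaken {n = suc n} _ (h , _) | inj₁ (s≤s m≤n) = ⋀¬D-weaken m≤n h

-- Definability in `𝒯 N` under the Continuity Principle

module _ (cp : ContinuityPrinciple) where

  -- Induction on `m`, mutual with `D-𝒯`: the first `m` conjuncts cut `𝒯 N` down to `𝒯 (suc n)`, and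
  -- one more removes its discrete points, leaving `𝒯 n`. Stating `N ≡ n + m` as an equation keeps
  -- the structure fixed while `n` and `m` shift.
  ⋀¬D-𝒯 : ∀ {j} n m → N ≡ n + m → (x : Fin j) (e : Vec 𝒩 j) → lookup e x ∈ 𝒯 N →
          (𝒯 N ⊨ ⋀¬D m x [ e ]) ⇔ lookup e x ∈ 𝒯 n

  -- The guard on the quantifier in `D m` confines it to `𝒯 (suc n)`. As the guard concerns the
  -- bound variable, the context `e` must be arbitrary.
  D-𝒯 : ∀ {j} n m → N ≡ suc n + m → (x : Fin j) (e : Vec 𝒩 j) → lookup e x ∈ 𝒯 N →
        (𝒯 N ⊨ D m x [ e ]) ⇔ (lookup e x ∈ 𝒯 (suc n) × Discrete (𝒯 (suc n)) (lookup e x))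

  ⋀¬D-𝒯 n zero    eq x e x∈ =
    mk⇔ (λ _ → subst (λ N → lookup e x ∈ 𝒯 N) (trans eq (+-identityʳ n)) x∈) (λ _ → tt)
  ⋀¬D-𝒯 n (suc m) eq x e x∈ = mk⇔
    (λ (h , ¬d) → let x∈′ = to IH h in
       ¬Discrete⇒𝒯 x∈′ (λ disc → ¬d (from (D-𝒯 n m eq′ x e x∈) (x∈′ , disc))))
    (λ x∈n → from IH (𝒯-weaken (n≤1+n n) x∈n) ,
       λ d → 𝒯⇒¬Discrete cp x∈n (proj₂ (to (D-𝒯 n m eq′ x e x∈) d)))
    where
    eq′ = trans eq (+-suc n m)
    IH  = ⋀¬D-𝒯 (suc n) m eq′ x e x∈

  D-𝒯 n m eq x e x∈ = mk⇔
    (λ d → let h , disc = to (D-⇔ m x e) d in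
       to (⋀¬D-𝒯 (suc n) m eq x e x∈) h ,
       λ γ γ∈ → let γ∈N = 𝒯-weaken sn≤N γ∈ in
         disc γ γ∈N (from (⋀¬D-𝒯 (suc n) m eq zero (γ ∷ e) γ∈N) γ∈))
    (λ (x∈′ , disc) → from (D-⇔ m x e)
       (from (⋀¬D-𝒯 (suc n) m eq x e x∈) x∈′ ,
        λ γ γ∈N h → disc γ (to (⋀¬D-𝒯 (suc n) m eq zero (γ ∷ e) γ∈N) h)))
    where
    sn≤N = ≤-trans (m≤m+n (suc n) m) (≤-reflexive (sym eq))

  𝒯≐⋀¬D : ∀ n m → N ≡ n + m →
          𝒯 n ≐ (λ α → α ∈ 𝒯 N × (𝒯 N ⊨ ⋀¬D m zero [ α ∷ [] ]))
  𝒯≐⋀¬D n m eq =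
    (λ {α} α∈ → let α∈N = 𝒯-weaken (≤-trans (m≤m+n n m) (≤-reflexive (sym eq))) α∈ in
       α∈N , from (⋀¬D-𝒯 n m eq zero (α ∷ []) α∈N) α∈) ,
    (λ {α} (α∈N , h) → to (⋀¬D-𝒯 n m eq zero (α ∷ []) α∈N) h)

  -- If `n ≤ m`, a witness satisfies the first `n` conjuncts within `𝒯 n`, which places it in the
  -- empty `𝒯 0`.
  ψ⇒≤ : ∀ n m → 𝒯 n ⊨ ψ m [ [] ] → suc m ≤ n
  ψ⇒≤ n m t = t _ ≤-irrelevant λ (α , α∈ , d) → ≰⇒> λ n≤m →
    ¬𝒯0 (to (⋀¬D-𝒯 0 n refl zero (α ∷ []) α∈)
      (⋀¬D-weaken n≤m (proj₁ (to (D-⇔ m zero (α ∷ [])) d))))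

  -- The environment `e` is left open because `ψ` evaluates `D m` with no further variable, whereas
  -- the uniqueness clause of `ρ` has its witness in scope.
  top⇒D : ∀ k m → N ≡ suc k + m → α ∈ 𝒯 (suc k) → ∀ p → α p ≡ k →
          α ∈ 𝒯 N × (∀ {j} (e : Vec 𝒩 j) → 𝒯 N ⊨ D m zero [ α ∷ e ])
  top⇒D {α = α} k m eq α∈ p αp≡k =
    α∈N , λ e → from (D-𝒯 k m eq zero (α ∷ e) α∈N) (α∈ , top⇒Discrete α∈ p αp≡k)
    where α∈N = 𝒯-weaken (≤-trans (m≤m+n (suc k) m) (≤-reflexive (sym eq))) α∈

  ≤⇒ψ : ∀ n m → suc m ≤ n → 𝒯 n ⊨ ψ m [ [] ]
  ≤⇒ψ n m m<n with m≤n⇒∃[o]m+o≡n m<n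
  -- Here `n` is `suc m + k`, so `k` is the top value of `𝒯 (suc k)` and the constant sequence `k`
  -- attains it at once.
  ... | k , refl =
    let α∈ , d = top⇒D k m (cong suc (+-comm m k)) (const∈𝒯 k) 0 refl
    in ∣ (λ _ → k) , α∈ , d [] ∣

  -- For k > 0 both the constant sequence k and 0, k, k, … satisfy D m in 𝒯 (k + m + 1).
  ρ⇒≡ : ∀ n m → 𝒯 n ⊨ ρ m [ [] ] → suc m ≡ n
  ρ⇒≡ n m t with m≤n⇒∃[o]m+o≡n (ψ⇒≤ n m (∥∥-map (λ (α , α∈ , d , _) → α , α∈ , d) t))
  ... | zero  , refl = sym (+-identityʳ (suc m))
  ... | suc k , refl = ⊥-elim (∥∥-absurd t λ (α , _ , _ , unique) →
    let eq      = cong suc (+-comm m (suc k))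
        δ∈      = jump∈𝒯 1 (𝒯-weaken (s≤s z≤n) (const∈𝒯 0))
        c∈ , dc = top⇒D (suc k) m eq (const∈𝒯 (suc k)) 0 refl
        j∈ , dj = top⇒D (suc k) m eq δ∈ 1 refl
        c≗α     = lower (unique _ c∈ (dc (α ∷ [])))
        j≗α     = lower (unique _ j∈ (dj (α ∷ [])))
    in 0≢1+n (trans (j≗α 0) (sym (c≗α 0))))

  -- In `𝒯 (suc m)` every solution of `D m` lies in `𝒯 1`, whose only element is the zero sequence.
  ≡⇒ρ : ∀ m → 𝒯 (suc m) ⊨ ρ m [ [] ]
  ≡⇒ρ m =
    let z∈ , d = top⇒D 0 m refl (const∈𝒯 0) 0 refl
    in ∣ (λ _ → 0) , z∈ , d [] , (λ γ γ∈ dγ →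
         lift (𝒯1-zero (proj₁ (to (D-𝒯 0 m refl zero (γ ∷ (λ _ → 0) ∷ []) γ∈) dγ)))) ∣

theorem7p7 : ContinuityPrinciple →
    (∀ n → IsTransparentSpread (𝒯 n) ×
    (n > 0 → ℐ (𝒯 n) ≐ (λ α → α ∈ 𝒯 n × (∃[ p ∶ ℕ ] α p + 1 ≡ n)) ×
    ℒ (𝒯 n) ≐ 𝒯 (n ∸ 1))) ×
    (∀ n m → m > 0 →
    𝒯 n ≐ (λ α → α ∈ 𝒯 (n + m) × (𝒯 (n + m) ⊨ ⋀¬D m zero [ α ∷ [] ]))) ×
    (∀ m →
    (λ α → α ≗ (λ _ → 0)) ≐ 𝒯 1 ×
    𝒯 1 ≐ (λ α → α ∈ 𝒯 (m + 1) × (𝒯 (m + 1) ⊨ ⋀¬D m zero [ α ∷ [] ]))) ×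
    (∀ n m → n > 0 → m > 0 → (𝒯 n ⊨ ψ m [ [] ]) ⇔ (m + 1 ≤ n)) ×
    (∀ n m → n > 0 → m > 0 → (𝒯 n ⊨ ρ m [ [] ]) ⇔ (m + 1 ≡ n))
theorem7p7 cp = part1 , part2 , part3 , part4 , part5
  where
  part1 : ∀ n → IsTransparentSpread (𝒯 n) ×
          (n > 0 → ℐ (𝒯 n) ≐ (λ α → α ∈ 𝒯 n × (∃[ p ∶ ℕ ] α p + 1 ≡ n)) ×
                   ℒ (𝒯 n) ≐ 𝒯 (n ∸ 1))
  part1 n = ∣ τ n , τ-spread n , ℱτ≐𝒯 n , τ-transparent n ∣ , derivative n
    where
    derivative : ∀ n → n > 0 → ℐ (𝒯 n) ≐ (λ α → α ∈ 𝒯 n × (∃[ p ∶ ℕ ] α p + 1 ≡ n)) ×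
                               ℒ (𝒯 n) ≐ 𝒯 (n ∸ 1)
    derivative (suc k) _ =
      ((λ α∈ℐ → proj₁ α∈ℐ ,
          ∥∥-map (λ (p , eq) → p , trans (+-comm _ 1) (cong suc eq)) (ℐ𝒯-to α∈ℐ)) ,
       (λ (α∈ , t) → ℐ𝒯-from α∈
          (∥∥-map (λ (p , eq) → p , suc-injective (trans (+-comm 1 _) eq)) t))) ,
      (ℒ𝒯-to , ℒ𝒯-from)

  part2 : ∀ n m → m > 0 →
          𝒯 n ≐ (λ α → α ∈ 𝒯 (n + m) × (𝒯 (n + m) ⊨ ⋀¬D m zero [ α ∷ [] ]))
  part2 n m _ = 𝒯≐⋀¬D cp n m refl

  part3 : ∀ m →
          (λ α → α ≗ (λ _ → 0)) ≐ 𝒯 1 ×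
          𝒯 1 ≐ (λ α → α ∈ 𝒯 (m + 1) × (𝒯 (m + 1) ⊨ ⋀¬D m zero [ α ∷ [] ]))
  part3 m =
    ((λ α≗0 → 𝒯-respects-≗ (λ i → sym (α≗0 i)) (const∈𝒯 0)) , 𝒯1-zero) ,
    𝒯≐⋀¬D cp 1 m (+-comm m 1)

  part4 : ∀ n m → n > 0 → m > 0 → (𝒯 n ⊨ ψ m [ [] ]) ⇔ (m + 1 ≤ n)
  part4 n m _ _ rewrite +-comm m 1 = mk⇔ (ψ⇒≤ cp n m) (≤⇒ψ cp n m)

  part5 : ∀ n m → n > 0 → m > 0 → (𝒯 n ⊨ ρ m [ [] ]) ⇔ (m + 1 ≡ n)
  part5 n m _ _ rewrite +-comm m 1 = mk⇔ (ρ⇒≡ cp n m) (λ { refl → ≡⇒ρ cp m })
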